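{- For all integers $n,d\ge0$, $T(n,\omega^d)\le P(n,\omega^d)$.
   Context: $[c]=\{1,\dots,c\}$; ordinals are identified with sets of smaller ordinals; $\approx$ is order-equivalence; $\binom{S}{n}$ is the set of $n$-element subsets. $T(n,S)$ is the least $t\in\mathbb{N}$ such that for every $c\ge1$ and every $\mathrm{COL}:\binom{S}{n}\to[c]$ there is $S'\subseteq S$, $S'\approx S$, with $|\mathrm{COL}(\binom{S'}{n})|\le t$ ($\infty$ if none). Every $\beta<\omega^d\cdot k$ is uniquely $\omega^d b+\sum_{j<d}\omega^j a_j$ with $0\le b<k$, $a_j\in\mathbb{N}$. A coloring rule (CR) on $\binom{\omega^d\cdot k}{n}$ is a pair $(\mathcal{Y},\preceq)$ with $\mathcal{Y}:\{1,\dots,n\}\to\{0,\dots,k-1\}$ and $\preceq$ a total preorder on $I=\{(i,j):1\le i\le n,0\le j<d\}$ (with induced equivalence $\equiv$ and strict part $\prec$) such that: (1) if $d\ge1$, $(i,0)\prec(i',0)$ for $i<i'$; if $d=0$, $\mathcal{Y}(i)<\mathcal{Y}(i')$ for $i<i'$; (2) $(i,j)\equiv(i',j)$ for some $j$ implies $\mathcal{Y}(i)=\mathcal{Y}(i')$; (3) $(i,j)\prec(i,j')$ for $j>j'$; (4) $(i,j)\equiv(i',j')$ implies $j=j'$; (5) for $j>0$, $(i,j)\not\equiv(i',j)$ implies $(i,j-1)\not\equiv(i',j-1)$. $P(n,\omega^d\cdot k)$ is the total number of CRs on $\binom{\omega^d\cdot k}{n}$, and $P(n,\omega^d)=P(n,\omega^d\cdot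 1)$. -}

module Defs where

open import Level using (0ℓ)
open import Data.Bool using (Bool; true; false; T; T?)
open import Data.Fin as Fin using (Fin; toℕ)
open import Data.Fin.Properties using (all?) renaming (_≟_ to _≟ᶠ_; <-isStrictTotalOrder to <ᶠ-isStrictTotalOrder)
open import Data.Fin.Subset using (Subset; ∣_∣) renaming (_∈_ to _∈ˢ_)
open import Data.List using (List; []; _∷_; length; filter; cartesianProduct; cartesianProductWith; allFin)
open import Data.List.Membership.Propositional using (_∈_)
open import Data.List.Membership.Propositional.Properties
  using (∈-filter⁺; ∈-filter⁻; ∈-cartesianProduct⁺; ∈-cartesianProductWith⁺; ∈-allFin)
open import Data.List.Relation.Unary.All using ([]; _∷_)
open import Data.List.Relation.Unary.AllPairs using ([]; _∷_)
open import Data.List.Relation.Unary.Any using (here; there)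
open import Data.List.Relation.Unary.Unique.Propositional using (Unique)
open import Data.List.Relation.Unary.Unique.Propositional.Properties
  using (filter⁺; cartesianProduct⁺; cartesianProductWith⁺; allFin⁺)
open import Data.Nat as ℕ using (ℕ; zero; suc; _≤_)
open import Data.Nat.Properties using ()
  renaming (_≟_ to _≟ⁿ_; <-isStrictTotalOrder to <ⁿ-isStrictTotalOrder)
open import Data.Product using (Σ-syntax; ∃; ∃-syntax; _×_; _,_; proj₁; proj₂)
open import Data.Product.Relation.Binary.Lex.Strict using (×-Lex; ×-isStrictTotalOrder)
open import Data.Vec using (Vec; []; _∷_; lookup)
open import Data.Vec.Properties using (∷-injective)
open import Data.Vec.Relation.Binary.Lex.Strict using (Lex-<) renaming (<-isStrictTotalOrder to lex-isStrictTotalOrder)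
open import Data.Vec.Relation.Binary.Pointwise.Inductive using (Pointwise-≡⇒≡; ≡⇒Pointwise-≡)
open import Data.Vec.Relation.Unary.All using (All)
open import Data.Vec.Relation.Unary.AllPairs using (AllPairs)
open import Function.Base using (_on_)
open import Function.Bundles using (_⇔_; mk⇔)
open import Relation.Binary.Core using (Rel)
open import Relation.Binary.Definitions using (Decidable; Trichotomous; tri<; tri≈; tri>)
open import Relation.Binary.Morphism.Structures using (IsOrderIsomorphism)
open import Relation.Binary.PropositionalEquality using (_≡_; refl; isEquivalence)
open import Relation.Binary.Structures using (IsTotalPreorder; IsStrictTotalOrder)
open import Relation.Nullary using (¬_; Dec)
open import Relation.Nullary.Construct.Add.Supremum public using (_⁺; [_]; ⊤⁺)
open import Relation.Nullary.Decidable using (_×-dec_; _→-dec_; _⊎-dec_; ¬?; map′)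
open import Relation.Unary using (Pred)
import Relation.Binary.Construct.Add.Supremum.NonStrict

open Relation.Binary.Construct.Add.Supremum.NonStrict _≤_ public using () renaming (_≤⁺_ to _≤∞_)

ℕ∞ : Set
ℕ∞ = ℕ ⁺

-- The set of ordinals below ω^d·k.  The pair (b , a_{d-1} ∷ … ∷ a_0 ∷ [])
-- stands for ω^d·b + ω^(d-1)·a_{d-1} + … + ω^0·a_0, so that the ordinal
-- order is the lexicographic one.
ω^_·_ : ℕ → ℕ → Set
ω^ d · k = Fin k × Vec ℕ d

_<ω_ : ∀ {d k} → Rel (ω^ d · k) 0ℓ
_<ω_ = ×-Lex _≡_ Fin._<_ (Lex-< _≡_ ℕ._<_)

private
  lex-order : ∀ {d k} → IsStrictTotalOrder _ (_<ω_ {d} {k})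
  lex-order {d} {k} =
    ×-isStrictTotalOrder (<ᶠ-isStrictTotalOrder {k}) (lex-isStrictTotalOrder <ⁿ-isStrictTotalOrder {d})

<ω-compare : ∀ {d k} → Trichotomous _≡_ (_<ω_ {d} {k})
<ω-compare x y with IsStrictTotalOrder.compare lex-order x y
... | tri< a b c = tri< a (λ { refl → b (refl , ≡⇒Pointwise-≡ refl) }) c
... | tri> a b c = tri> a (λ { refl → b (refl , ≡⇒Pointwise-≡ refl) }) c
... | tri≈ a (refl , p) c with refl ← Pointwise-≡⇒≡ p = tri≈ a refl c

<ω-isStrictTotalOrder : ∀ {d k} → IsStrictTotalOrder _≡_ (_<ω_ {d} {k})
<ω-isStrictTotalOrder = record
  { isStrictPartialOrder = record
      { isEquivalence = isEquivalence
      ; irrefl        = λ { refl → IsStrictTotalOrder.irrefl lex-order (refl , ≡⇒Pointwise-≡ refl) }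
      ; trans         = IsStrictTotalOrder.trans lex-order
      ; <-resp-≈      = (λ { refl p → p }) , (λ { refl p → p })
      }
  ; compare = <ω-compare
  }

-- S is meant to be strictly totally ordered by _<_.
module _ {S : Set} (_<_ : Rel S 0ℓ) where

  -- An n-element subset of S, listed in increasing order.  The proof of
  -- increasingness is irrelevant, so two subsets with the same elements are
  -- equal and a colouring cannot distinguish them.
  record [_]-subset (n : ℕ) : Set where
    constructor subset
    field
      elements    : Vec S n
      .increasing : AllPairs _<_ elements

  open [_]-subset public

  _⊆ₛ_ : ∀ {n} → [_]-subset n → Pred S 0ℓ → Set
  e ⊆ₛ S′ = All S′ (elements e)

  -- S′ ≈ S, where two elements of S′ are equal when they are equal in S.
  OrderEquivalent : Pred S 0ℓ → Set
  OrderEquivalent S′ = Σ[ f ∈ (S → ∃ S′) ]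
    IsOrderIsomorphism _≡_ (_≡_ on proj₁) _<_ (_<_ on proj₁) f

  -- C = COL(binom(S′, n))
  IsImage : ∀ {n c} → ([_]-subset n → Fin c) → Pred S 0ℓ → Subset c → Set
  IsImage COL S′ C = ∀ i → i ∈ˢ C ⇔ (∃[ e ] e ⊆ₛ S′ × COL e ≡ i)

  Suffices : ℕ → ℕ → Set₁
  Suffices n t = ∀ c → 1 ≤ c → (COL : [_]-subset n → Fin c) →
    Σ[ S′ ∈ Pred S 0ℓ ] OrderEquivalent S′ ×
      (Σ[ C ∈ Subset c ] IsImage COL S′ C × ∣ C ∣ ≤ t)

  -- The graph of T(n,S): IsT n t says that T(n,S) = t.
  IsT : ℕ → ℕ∞ → Set₁
  IsT n [ t ] = Suffices n t × (∀ s → Suffices n s → t ≤ s)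
  IsT n ⊤⁺    = ∀ t → ¬ Suffices n t

module Induced {A : Set} (_⪯_ : Rel A 0ℓ) where
  _≈_ _≺_ : Rel A 0ℓ
  x ≈ y = x ⪯ y × y ⪯ x
  x ≺ y = x ⪯ y × ¬ y ⪯ x

-- Indices are 0-based: i : Fin n plays the role of i + 1 ∈ {1,…,n}.
record IsCR {n d k : ℕ} (Y : Fin n → Fin k) (_⪯_ : Rel (Fin n × Fin d) 0ℓ) : Set where
  open Induced _⪯_
  field
    isTotalPreorder : IsTotalPreorder _≡_ _⪯_
    cond₁  : ∀ i i′ (j : Fin d) → toℕ j ≡ 0 → i Fin.< i′ → (i , j) ≺ (i′ , j)
    cond₁₀ : d ≡ 0 → ∀ i i′ → i Fin.< i′ → Y i Fin.< Y i′
    cond₂  : ∀ i i′ j → (i , j) ≈ (i′ , j) → Y i ≡ Y i′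
    cond₃  : ∀ i j j′ → j′ Fin.< j → (i , j) ≺ (i , j′)
    cond₄  : ∀ i i′ j j′ → (i , j) ≈ (i′ , j′) → j ≡ j′
    cond₅  : ∀ i i′ j j⁻ → toℕ j ≡ suc (toℕ j⁻) →
             ¬ (i , j) ≈ (i′ , j) → ¬ (i , j⁻) ≈ (i′ , j⁻)

open IsCR using (isTotalPreorder; cond₁; cond₁₀; cond₂; cond₃; cond₄; cond₅)

isCR? : ∀ {n d k} (Y : Fin n → Fin k) {_⪯_ : Rel (Fin n × Fin d) 0ℓ} → Decidable _⪯_ → Dec (IsCR Y _⪯_)
isCR? {n} {d} {k} Y {_⪯_} _⪯?_ = map′
  (λ (r , t , tot , c₁ , c₁₀ , c₂ , c₃ , c₄ , c₅) → record
    { isTotalPreorder = record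
      { isPreorder = record
        { isEquivalence = isEquivalence
        ; reflexive = λ { {i , j} refl → r i j }
        ; trans = λ { {i , j} {i′ , j′} {i″ , j″} p q → t i j i′ j′ p i″ j″ q } }
      ; total = λ { (i , j) (i′ , j′) → tot i j i′ j′ } }
    ; cond₁ = c₁ ; cond₁₀ = c₁₀ ; cond₂ = c₂ ; cond₃ = c₃ ; cond₄ = c₄ ; cond₅ = c₅ })
  (λ cr →
      (λ i j → IsTotalPreorder.refl (isTotalPreorder cr))
    , (λ i j i′ j′ p i″ j″ q → IsTotalPreorder.trans (isTotalPreorder cr) p q)
    , (λ i j i′ j′ → IsTotalPreorder.total (isTotalPreorder cr) _ _)
    , cond₁ cr , cond₁₀ cr , cond₂ cr , cond₃ cr , cond₄ cr , cond₅ cr)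
  ( (all? λ i → all? λ j → (i , j) ⪯? (i , j))
  ×-dec (all? λ i → all? λ j → all? λ i′ → all? λ j′ → ((i , j) ⪯? (i′ , j′)) →-dec
          (all? λ i″ → all? λ j″ → ((i′ , j′) ⪯? (i″ , j″)) →-dec ((i , j) ⪯? (i″ , j″))))
  ×-dec (all? λ i → all? λ j → all? λ i′ → all? λ j′ → ((i , j) ⪯? (i′ , j′)) ⊎-dec ((i′ , j′) ⪯? (i , j)))
  ×-dec (all? λ i → all? λ i′ → all? λ j → (toℕ j ≟ⁿ 0) →-dec (i Fin.<? i′) →-dec ((i , j) ≺? (i′ , j)))
  ×-dec ((d ≟ⁿ 0) →-dec (all? λ i → all? λ i′ → (i Fin.<? i′) →-dec (Y i Fin.<? Y i′)))
  ×-dec (all? λ i → all? λ i′ → all? λ j → ((i , j) ≈? (i′ , j)) →-dec (Y i ≟ᶠ Y i′))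
  ×-dec (all? λ i → all? λ j → all? λ j′ → (j′ Fin.<? j) →-dec ((i , j) ≺? (i , j′)))
  ×-dec (all? λ i → all? λ i′ → all? λ j → all? λ j′ → ((i , j) ≈? (i′ , j′)) →-dec (j ≟ᶠ j′))
  ×-dec (all? λ i → all? λ i′ → all? λ j → all? λ j⁻ → (toℕ j ≟ⁿ suc (toℕ j⁻)) →-dec
          ¬? ((i , j) ≈? (i′ , j)) →-dec ¬? ((i , j⁻) ≈? (i′ , j⁻))))
  where
  open Induced _⪯_
  _≈?_ : Decidable _≈_
  x ≈? y = (x ⪯? y) ×-dec (y ⪯? x)
  _≺?_ : Decidable _≺_
  x ≺? y = (x ⪯? y) ×-dec ¬? (y ⪯? x)

-- Candidates (𝒴 , ⪯) as finite tables: a vector of values of 𝒴 and the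
-- Boolean matrix of ⪯, whose entry i, j, i′, j′ says whether (i,j) ⪯ (i′,j′).
Candidate : ℕ → ℕ → ℕ → Set
Candidate n d k = Vec (Fin k) n × Vec (Vec (Vec (Vec Bool d) n) d) n

⟦_⟧ : ∀ {n d} → Vec (Vec (Vec (Vec Bool d) n) d) n → Rel (Fin n × Fin d) 0ℓ
⟦ M ⟧ (i , j) (i′ , j′) = T (lookup (lookup (lookup (lookup M i) j) i′) j′)

CR : ∀ {n d k} → Candidate n d k → Set
CR (Y , M) = IsCR (lookup Y) ⟦ M ⟧

CR? : ∀ {n d k} (x : Candidate n d k) → Dec (CR x)
CR? (Y , M) = isCR? (lookup Y) (λ _ _ → T? _)

vectors : ∀ {A : Set} → List A → ∀ n → List (Vec A n)
vectors xs zero    = [] ∷ []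
vectors xs (suc n) = cartesianProductWith _∷_ xs (vectors xs n)

candidates : ∀ n d k → List (Candidate n d k)
candidates n d k = cartesianProduct
  (vectors (allFin k) n)
  (vectors (vectors (vectors (vectors (true ∷ false ∷ []) d) n) d) n)

allCRs : ∀ n d k → List (Candidate n d k)
allCRs n d k = filter CR? (candidates n d k)

-- P(n, ω^d·k); allCRs-unique and ∈-allCRs below say that allCRs lists every
-- coloring rule exactly once.
P : ℕ → ℕ → ℕ → ℕ
P n d k = length (allCRs n d k)

vectors-unique : ∀ {A : Set} {xs : List A} → Unique xs → ∀ n → Unique (vectors xs n)
vectors-unique u zero    = [] ∷ []
vectors-unique u (suc n) = cartesianProductWith⁺ _∷_ ∷-injective u (vectors-unique u n)

∈-vectors : ∀ {A : Set} {xs : List A} → (∀ x → x ∈ xs) → ∀ {n} (v : Vec A n) → v ∈ vectors xs n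
∈-vectors h []      = here refl
∈-vectors h (x ∷ v) = ∈-cartesianProductWith⁺ _∷_ (h x) (∈-vectors h v)

allCRs-unique : ∀ n d k → Unique (allCRs n d k)
allCRs-unique n d k = filter⁺ CR? (cartesianProduct⁺
  (vectors-unique (allFin⁺ k) n)
  (vectors-unique (vectors-unique (vectors-unique (vectors-unique (((λ ()) ∷ []) ∷ [] ∷ []) d) n) d) n))

∈-allCRs : ∀ {n d k} (x : Candidate n d k) → x ∈ allCRs n d k ⇔ CR x
∈-allCRs {n} {d} {k} x@(Y , M) = mk⇔
  (λ p → proj₂ (∈-filter⁻ CR? {xs = candidates n d k} p))
  (λ c → ∈-filter⁺ CR?
    (∈-cartesianProduct⁺ (∈-vectors ∈-allFin Y)
      (∈-vectors (∈-vectors (∈-vectors (∈-vectors λ { true → here refl ; false → there (here refl) }))) M)) c)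

{-# OPTIONS --safe #-}

-- Order the elements of an n-set by their last coordinates; the order pattern of all coordinates is then a
-- coloring rule, provided the set lies in a suitable copy of ω^d: replace x by the sequence of codes of its
-- nonempty prefixes, where the code is injective, so that equal coordinates come from equal prefixes.
-- Ramsey's theorem yields an infinite H ⊆ ℕ such that, once all coordinates are renamed by the increasing
-- enumeration of H, the colour of an n-set depends only on its order pattern.  So the copy has at most as
-- many colours as there are coloring rules.

module Submission where

open import Defs
open import Axiom.ExcludedMiddle using (ExcludedMiddle)
open import Data.Bool using (Bool; T)
open import Data.Bool.Properties using (T-≡)
open import Data.Fin as Fin using (Fin; zero; suc; toℕ; fromℕ; inject₁; opposite; combine; remQuot; funToFin; finToFun)
open import Data.Fin.Induction using (<-weakInduction)
open import Data.Fin.Properties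
  using (punchIn-punchOut; finToFun-funToFin; remQuot-combine; toℕ-injective; toℕ-inject₁; toℕ-fromℕ; toℕ<n;
         inject₁-injective; opposite-prop; opposite-involutive)
  renaming (suc-injective to suc-injectiveᶠ)
open import Data.Fin.Subset as Subset using (Subset; ∣_∣; _∪_; ⁅_⁆; inside; outside) renaming (_∈_ to _∈ˢ_)
open import Data.Fin.Subset.Properties using (∪-identityˡ; p⊆q⇒∣p∣≤∣q∣; x∈p∪q⁺; x∈⁅x⁆; ∣⊥∣≡0)
open import Data.List as List using (List; []; _∷_; length)
import Data.List.Membership.Propositional as List
open import Data.List.Membership.Propositional.Properties using () renaming (∈-map⁺ to ∈ᴸ-map⁺)
open import Data.List.Properties using (length-map)
open import Data.List.Relation.Unary.Any using (here; there)
open import Data.Nat using (ℕ; zero; suc; _+_; _*_; _∸_; _^_; _≤_; _<_; _≤?_; z≤n; s≤s; z<s; s<s)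
open import Data.Nat.Properties
open import Data.Product using (Σ-syntax; ∃; ∃-syntax; _×_; _,_; proj₁; proj₂)
open import Data.Product.Properties using (≡-dec)
open import Data.Sum as Sum using (_⊎_; inj₁; inj₂)
open import Data.Vec using (Vec; []; _∷_; lookup; map; tabulate; replicate)
open import Data.Vec.Membership.Propositional using (_∈_)
open import Data.Vec.Membership.Propositional.Properties using (∈-map⁺; ∈-tabulate⁺)
open import Data.Vec.Properties
  using (map-∘; lookup-map; lookup∘tabulate; tabulate∘lookup; tabulate-cong; lookup⇒[]=; []=⇒lookup)
open import Data.Vec.Relation.Binary.Lex.Strict using (Lex-<; this; next)
open import Data.Vec.Relation.Unary.All as All using (All; []; _∷_)
import Data.Vec.Relation.Unary.All.Properties as All
open import Data.Vec.Relation.Unary.AllPairs as AllPairs using (AllPairs; []; _∷_)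
import Data.Vec.Relation.Unary.AllPairs.Properties as AllPairs
open import Data.Vec.Relation.Unary.Any as Any using (here; there)
open import Data.Vec.Relation.Unary.Any.Properties using (lookup-index)
open import Function using (_∘_; id; _on_)
open import Function.Bundles using (_⇔_; mk⇔; Equivalence)
open import Level using (0ℓ)
open import Relation.Binary.Construct.Add.Supremum.NonStrict _≤_ using ([_])
open import Relation.Binary.Core using (Rel)
open import Relation.Binary.Definitions
  using (DecidableEquality; Monotonic₁; Transitive; Asymmetric; tri<; tri≈; tri>)
open import Relation.Binary.PropositionalEquality
open import Relation.Binary.Structures using (IsStrictTotalOrder)
open import Relation.Nullary using (yes; no; contradiction)
open import Relation.Nullary.Decidable using (toWitness; fromWitness; isYes; recompute)
open import Relation.Unary using (Pred)

open Equivalence using (to; from)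

-- Infinite Ramsey theorem for increasing sequences of naturals.

StrictlyMonotone : (ℕ → ℕ) → Set
StrictlyMonotone = Monotonic₁ _<_ _<_

Increasing : ∀ {n} → Vec ℕ n → Set
Increasing = AllPairs _<_

map-increasing : ∀ {f n} {v : Vec ℕ n} → StrictlyMonotone f → Increasing v → Increasing (map f v)
map-increasing mono = AllPairs.map⁺ ∘ AllPairs.map mono

stepwise⇒StrictlyMonotone : ∀ {f} → (∀ k → f k < f (suc k)) → StrictlyMonotone f
stepwise⇒StrictlyMonotone step {i} {suc j} (s≤s i≤j) with m≤n⇒m<n∨m≡n i≤j
... | inj₁ i<j  = <-trans (stepwise⇒StrictlyMonotone step i<j) (step j)
... | inj₂ refl = step i

∸-increasing : ∀ m {n} {v : Vec ℕ n} → All (m ≤_) v → Increasing v → Increasing (map (_∸ m) v)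
∸-increasing m []       []         = []
∸-increasing m (p ∷ ps) (lt ∷ inc) = All.map⁺ (All.map (λ x<y → ∸-monoˡ-< x<y p) lt) ∷ ∸-increasing m ps inc

+-∸-cancel : ∀ m {n} {v : Vec ℕ n} → All (m ≤_) v → map (m +_) (map (_∸ m) v) ≡ v
+-∸-cancel m []       = refl
+-∸-cancel m (p ∷ ps) = cong₂ _∷_ (m+[n∸m]≡n p) (+-∸-cancel m ps)

-- The infinite homogeneous set is the range of `H`; its `N`-element subsets are the vectors
-- `map H v` with `v` increasing.
Homogeneous : ∀ {N c} → (Vec ℕ N → Fin c) → Set
Homogeneous COL = ∃[ H ] StrictlyMonotone H × ∃[ a ] (∀ {v} → Increasing v → COL (map H v) ≡ a)

-- From an infinite set H keep the least element and thin out the rest so that the colour of a set with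
-- that least element no longer depends on its other elements; iterate.
module Prehomogeneous {N c} (ramsey : (COL : Vec ℕ N → Fin c) → Homogeneous COL)
                      (COL : Vec ℕ (suc N) → Fin c) where

  thin : (H : ℕ → ℕ) → Homogeneous (λ v → COL (H 0 ∷ map (H ∘ ℕ.suc) v))
  thin H = ramsey (λ v → COL (H 0 ∷ map (H ∘ ℕ.suc) v))

  refine : (ℕ → ℕ) → ℕ → ℕ
  refine H = H ∘ ℕ.suc ∘ proj₁ (thin H)

  -- Yields positions in `H`, so that the prehomogeneous sequence itself is `H ∘ pick H`.
  pick : (ℕ → ℕ) → ℕ → ℕ
  pick H zero    = 0
  pick H (suc k) = suc (proj₁ (thin H) (pick (refine H) k))

  colour : (ℕ → ℕ) → ℕ → Fin c
  colour H zero    = proj₁ (proj₂ (proj₂ (thin H)))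
  colour H (suc k) = colour (refine H) k

  pick-mono : ∀ H → StrictlyMonotone (pick H)
  pick-mono H {zero}  {suc l} _         = z<s
  pick-mono H {suc k} {suc l} (s≤s k<l) = s<s (proj₁ (proj₂ (thin H)) (pick-mono (refine H) k<l))

  -- Writing the tail as offsets from `suc k` permits induction on `k`. At 0 this is the homogeneity
  -- of `thin H`; at a successor, every index drops by one and `H` is replaced by `refine H`.
  pick-colour : ∀ H k {v} → Increasing v → COL (map (H ∘ pick H) (k ∷ map (suc k +_) v)) ≡ colour H k
  pick-colour H zero {v} inc = trans
    (cong (COL ∘ (H 0 ∷_)) (begin
      map (H ∘ pick H) (map ℕ.suc v)                              ≡⟨ map-∘ (H ∘ pick H) ℕ.suc v ⟨
      map (H ∘ ℕ.suc ∘ proj₁ (thin H) ∘ pick (refine H)) v          ≡⟨ map-∘ (H ∘ ℕ.suc) _ v ⟩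
      map (H ∘ ℕ.suc) (map (proj₁ (thin H) ∘ pick (refine H)) v)    ≡⟨ cong (map (H ∘ ℕ.suc)) (map-∘ _ (pick (refine H)) v) ⟩
      map (H ∘ ℕ.suc) (map (proj₁ (thin H)) (map (pick (refine H)) v)) ∎))
    (proj₂ (proj₂ (proj₂ (thin H))) (map-increasing (pick-mono (refine H)) inc))
    where open ≡-Reasoning
  pick-colour H (suc k) {v} inc = trans
    (cong (COL ∘ (H (pick H (suc k)) ∷_)) (trans (sym (map-∘ _ _ v)) (map-∘ _ (suc k +_) v)))
    (pick-colour (refine H) k inc)

  monochromatic : ∀ {K a} → StrictlyMonotone K → (∀ k → colour id (K k) ≡ a) → Homogeneous COL
  monochromatic {K} {a} K-mono const = pick id ∘ K , pick-mono id ∘ K-mono , a , homogeneous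
    where
    homogeneous : ∀ {v} → Increasing v → COL (map (pick id ∘ K) v) ≡ a
    homogeneous {x ∷ v} (lt ∷ inc) = begin
      COL (map (pick id ∘ K) (x ∷ v))
        ≡⟨ cong COL (map-∘ (pick id) K (x ∷ v)) ⟩
      COL (map (pick id) (K x ∷ map K v))
        -- The indices after `K x` are rewritten as offsets from `suc (K x)`, the form required by
        -- `pick-colour`.
        ≡⟨ cong (COL ∘ map (pick id) ∘ (K x ∷_)) (+-∸-cancel (suc (K x)) above) ⟨
      COL (map (pick id) (K x ∷ map (suc (K x) +_) (map (_∸ suc (K x)) (map K v))))
        ≡⟨ pick-colour id (K x) (∸-increasing (suc (K x)) above (map-increasing K-mono inc)) ⟩
      colour id (K x)
        ≡⟨ const x ⟩
      a ∎
      where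
      open ≡-Reasoning
      above : All (suc (K x) ≤_) (map K v)
      above = All.map⁺ (All.map K-mono lt)

module Ramsey (em : ExcludedMiddle 0ℓ) where

  -- Induction on the number of colours: either `zero` is avoided from some `m` on and can be
  -- punched out, or it recurs beyond every bound and its occurrences are enumerated.
  pigeonhole : ∀ {c} (f : ℕ → Fin c) → ∃[ K ] StrictlyMonotone K × ∃[ a ] (∀ k → f (K k) ≡ a)
  pigeonhole {zero}  f with () ← f 0
  pigeonhole {suc c} f with em {∃[ m ] (∀ k → zero ≢ f (m + k))}
  ... | yes (m , avoids) with K , mono , a , const ← pigeonhole (λ k → Fin.punchOut (avoids k)) =
    (m +_) ∘ K , +-monoʳ-< m ∘ mono , suc a ,
    λ k → trans (sym (punchIn-punchOut (avoids (K k)))) (cong suc (const k))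
  ... | no ¬avoids = K , stepwise⇒StrictlyMonotone step , zero , const
    where
    recur : ∀ m → ∃[ k ] zero ≡ f (m + k)
    recur m with em {∃[ k ] zero ≡ f (m + k)}
    ... | yes r = r
    ... | no ¬r = contradiction (m , λ k eq → ¬r (k , eq)) ¬avoids

    after : ℕ → ℕ
    after m = m + proj₁ (recur m)

    K : ℕ → ℕ
    K zero    = after 0
    K (suc k) = after (suc (K k))

    step : ∀ k → K k < K (suc k)
    step k = m≤m+n (suc (K k)) _

    const : ∀ k → f (K k) ≡ zero
    const zero    = sym (proj₂ (recur 0))
    const (suc k) = sym (proj₂ (recur (suc (K k))))

  ramsey : ∀ N {c} (COL : Vec ℕ N → Fin c) → Homogeneous COL
  ramsey zero    COL = id , id , COL [] , λ { [] → refl }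
  ramsey (suc N) COL = let (_ , mono , _ , const) = pigeonhole (colour id) in monochromatic mono const
    where open Prehomogeneous (ramsey N) COL

-- Sorting finite vectors and comparing their members.

∈⇒All : ∀ {A : Set} {P : A → Set} {n} {xs : Vec A n} → (∀ {x} → x ∈ xs → P x) → All P xs
∈⇒All {xs = []}    h = []
∈⇒All {xs = _ ∷ _} h = h (here refl) ∷ ∈⇒All (h ∘ there)

module _ {A : Set} {_≺_ : Rel A 0ℓ} (≺-trans : Transitive _≺_) where

  insert : ∀ {n} x (ys : Vec A n) → All (λ y → x ≺ y ⊎ y ≺ x) ys → AllPairs _≺_ ys →
           Σ[ zs ∈ Vec A (suc n) ] AllPairs _≺_ zs × (∀ {z} → z ∈ zs ⇔ z ∈ x ∷ ys)
  insert x []       []              []        = x ∷ [] , [] ∷ [] , mk⇔ id id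
  insert x (y ∷ ys) (inj₁ x≺y ∷ _)  (lt ∷ s)  =
    x ∷ y ∷ ys , (x≺y ∷ All.map (≺-trans x≺y) lt) ∷ lt ∷ s , mk⇔ id id
  insert x (y ∷ ys) (inj₂ y≺x ∷ cs) (lt ∷ s) with zs , s′ , same ← insert x ys cs s =
    y ∷ zs ,
    ∈⇒All (λ z∈zs → All.lookup (y≺x ∷ lt) (to same z∈zs)) ∷ s′ ,
    mk⇔ (λ { (here p) → there (here p) ; (there p) → swap (to same p) })
        (λ { (here p) → there (from same (here p)) ; (there (here p)) → here p
           ; (there (there p)) → there (from same (there p)) })
    where
    swap : ∀ {z} → z ∈ x ∷ ys → z ∈ x ∷ y ∷ ys
    swap (here p)  = here p
    swap (there p) = there (there p)

  -- The comparisons come as evidence for each pair in the vector, which allows sorting by the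
  -- partial order `_⊏_` as well as by `key`.
  sort : ∀ {n} (xs : Vec A n) → AllPairs (λ x y → x ≺ y ⊎ y ≺ x) xs →
         Σ[ ys ∈ Vec A n ] AllPairs _≺_ ys × (∀ {z} → z ∈ ys ⇔ z ∈ xs)
  sort []       []       = [] , [] , mk⇔ id id
  sort (x ∷ xs) (c ∷ cs)
    with ys , ys-sorted , ys~xs ← sort xs cs
    with zs , zs-sorted , zs~x∷ys ← insert x ys (∈⇒All (All.lookup c ∘ to ys~xs)) ys-sorted =
    zs , zs-sorted ,
    mk⇔ (Any.fromSum ∘ Sum.map₂ (to ys~xs) ∘ Any.toSum ∘ to zs~x∷ys)
        (λ { (here p) → from zs~x∷ys (here p) ; (there p) → from zs~x∷ys (there (from ys~xs p)) })

  -- Were the heads different, each would lie in the other's tail and so precede the other, against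
  -- asymmetry.
  sorted-unique : Asymmetric _≺_ → ∀ {n} {xs ys : Vec A n} → AllPairs _≺_ xs → AllPairs _≺_ ys →
                  (∀ {z} → z ∈ xs ⇔ z ∈ ys) → xs ≡ ys
  sorted-unique asym []         []         same = refl
  sorted-unique asym {xs = x ∷ xs} {y ∷ ys} (x≺ ∷ xs-sorted) (y≺ ∷ ys-sorted) same =
    cong₂ _∷_ x≡y (sorted-unique asym xs-sorted ys-sorted
      (mk⇔ (λ z∈xs → drop x≡y x≺ z∈xs (to same (there z∈xs)))
           (λ z∈ys → drop (sym x≡y) y≺ z∈ys (from same (there z∈ys)))))
    where
    x≡y : x ≡ y
    x≡y with to same (here refl) | from same (here refl)
    ... | here p     | _          = p
    ... | there _    | here p     = sym p
    ... | there x∈ys | there y∈xs = contradiction (All.lookup y≺ x∈ys) (asym (All.lookup x≺ y∈xs))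
    drop : ∀ {n x y z} {xs : Vec A n} {ys : Vec A n} → x ≡ y → All (x ≺_) xs → z ∈ xs → z ∈ y ∷ ys → z ∈ ys
    drop refl x≺ z∈xs (here refl)  = contradiction (All.lookup x≺ z∈xs) λ p → asym p p
    drop refl x≺ z∈xs (there z∈ys) = z∈ys

module _ {A : Set} (_≟_ : DecidableEquality A) {S : Rel A 0ℓ} where

  deduplicate : ∀ {n} (xs : Vec A n) → AllPairs (λ x y → x ≡ y ⊎ S x y) xs →
                ∃[ m ] m ≤ n × Σ[ ys ∈ Vec A m ] AllPairs S ys × (∀ {z} → z ∈ ys ⇔ z ∈ xs)
  deduplicate [] [] = 0 , z≤n , [] , [] , mk⇔ id id
  deduplicate (x ∷ xs) (x~ ∷ xs~) with deduplicate xs xs~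
  ... | m , m≤n , ys , ys! , same with Any.any? (x ≟_) ys
  ...   | yes x∈ys = m , m≤n⇒m≤1+n m≤n , ys , ys! ,
                     mk⇔ (there ∘ to same) λ { (here refl) → x∈ys ; (there p) → from same p }
  ...   | no  x∉ys = suc m , s≤s m≤n , x ∷ ys , ∈⇒All fresh ∷ ys! ,
                     mk⇔ (λ { (here p) → here p ; (there p) → there (to same p) })
                         (λ { (here p) → here p ; (there p) → there (from same p) })
    where
    fresh : ∀ {y} → y ∈ ys → S x y
    fresh y∈ys with All.lookup x~ (to same y∈ys)
    ... | inj₁ refl = contradiction y∈ys x∉ys
    ... | inj₂ s    = s

-- Ramsey's theorem for order types of index maps and matrices.

_⊏_ : Rel (ℕ × ℕ) 0ℓ
(a , b) ⊏ (c , d) = a < c × b < d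

⊏-trans : Transitive _⊏_
⊏-trans (p , q) (r , s) = <-trans p r , <-trans q s

-- Makes up for the length lost in removing repetitions: once `ps` runs out, the diagonal pairs
-- `(a , b)`, `(suc a , suc b)`, ... are appended, with `a` and `b` just beyond the last pair.
pad : ∀ {k m} → k ≤ m → (a b : ℕ) (ps : Vec (ℕ × ℕ) k) →
      All (λ (x , y) → a ≤ x × b ≤ y) ps → AllPairs _⊏_ ps →
      Σ[ qs ∈ Vec (ℕ × ℕ) m ] All (λ (x , y) → a ≤ x × b ≤ y) qs × AllPairs _⊏_ qs × (∀ {p} → p ∈ ps → p ∈ qs)
pad {m = zero}  z≤n a b [] [] [] = [] , [] , [] , id
pad {m = suc m} z≤n a b [] [] []
  with qs , bound , chain , _ ← pad {m = m} z≤n (suc a) (suc b) [] [] [] =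
  (a , b) ∷ qs , (≤-refl , ≤-refl) ∷ All.map (λ (p , q) → <⇒≤ p , <⇒≤ q) bound , bound ∷ chain , λ ()
pad (s≤s k≤m) a b ((x , y) ∷ ps) ((a≤x , b≤y) ∷ _) (lt ∷ chain)
  with qs , bound , chain′ , incl ← pad k≤m (suc x) (suc y) ps lt chain =
  (x , y) ∷ qs , (a≤x , b≤y) ∷ All.map (λ (p , q) → ≤-trans a≤x (<⇒≤ p) , ≤-trans b≤y (<⇒≤ q)) bound ,
  bound ∷ chain′ , λ { (here p) → here p ; (there p) → there (incl p) }

-- Ties are compared too: `f i ≡ f j` exactly when `g i ≡ g j`, by antisymmetry.
SameOrder : {I : Set} → (f g : I → ℕ) → Set
SameOrder f g = ∀ i j → f i ≤ f j ⇔ g i ≤ g j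

-- Sort the pairs (f i , g i): two maps of the same order type factor through one map of indices into
-- increasing sequences.
common-indexing : ∀ {N} {f g : Fin N → ℕ} → SameOrder f g →
  Σ[ r ∈ (Fin N → Fin N) ] Σ[ u ∈ Vec ℕ N ] Σ[ v ∈ Vec ℕ N ] Increasing u × Increasing v ×
    (∀ i → lookup u (r i) ≡ f i) × (∀ i → lookup v (r i) ≡ g i)
common-indexing {N} {f} {g} same =
  let m , m≤N , ps , distinct , ps~ = deduplicate (≡-dec _≟_ _≟_) pairs
                                        (AllPairs.tabulate⁺ (λ {i} {j} _ → comparable i j))
      qs , qs-sorted , qs~          = sort ⊏-trans ps distinct
      rs , _ , rs-sorted , incl     = pad m≤N 0 0 qs (∈⇒All (λ _ → z≤n , z≤n)) qs-sorted
      mem : ∀ i → (f i , g i) ∈ rs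
      mem i = incl (from qs~ (from ps~ (∈-tabulate⁺ (λ i → f i , g i) i)))
  in Any.index ∘ mem , map proj₁ rs , map proj₂ rs ,
     AllPairs.map⁺ (AllPairs.map proj₁ rs-sorted) , AllPairs.map⁺ (AllPairs.map proj₂ rs-sorted) ,
     (λ i → trans (lookup-map _ proj₁ rs) (cong proj₁ (sym (lookup-index (mem i))))) ,
     (λ i → trans (lookup-map _ proj₂ rs) (cong proj₂ (sym (lookup-index (mem i)))))
  where
  pairs : Vec (ℕ × ℕ) N
  pairs = tabulate (λ i → f i , g i)

  smaller : ∀ {i j} → f i < f j → g i < g j
  smaller fi<fj = ≰⇒> (<⇒≱ fi<fj ∘ from (same _ _))

  comparable : ∀ i j → (f i , g i) ≡ (f j , g j) ⊎ (f i , g i) ⊏ (f j , g j) ⊎ (f j , g j) ⊏ (f i , g i)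
  comparable i j with <-cmp (f i) (f j)
  ... | tri< lt _ _ = inj₂ (inj₁ (lt , smaller lt))
  ... | tri> _ _ gt = inj₂ (inj₂ (gt , smaller gt))
  ... | tri≈ _ eq _ = inj₁ (cong₂ _,_ eq (≤-antisym
                        (to (same i j) (≤-reflexive eq)) (to (same j i) (≤-reflexive (sym eq)))))

entry : ∀ {n d} → Vec (Vec ℕ d) n → Fin n × Fin d → ℕ
entry X (i , j) = lookup (lookup X i) j

module OrderRamsey (em : ExcludedMiddle 0ℓ) where
  open Ramsey em

  -- Colour an increasing sequence u by the function taking each index map r to the colour of u ∘ r.
  order-ramsey : ∀ {N c} (COL : Vec ℕ N → Fin c) →
    ∃[ H ] StrictlyMonotone H × (∀ f g → SameOrder f g → COL (tabulate (H ∘ f)) ≡ COL (tabulate (H ∘ g)))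
  order-ramsey {N} {c} COL = H , mono , same-colour
    where
    reindex : Vec ℕ N → (Fin N → Fin N) → Vec ℕ N
    reindex u r = tabulate (lookup u ∘ r)

    COL′ : Vec ℕ N → Fin (c ^ (N ^ N))
    COL′ u = funToFin (λ t → COL (reindex u (finToFun t)))

    hom   = ramsey N COL′
    H     = proj₁ hom
    mono  = proj₁ (proj₂ hom)
    const = proj₂ (proj₂ (proj₂ hom))

    unfold : ∀ u r → finToFun (COL′ u) (funToFin r) ≡ COL (reindex u r)
    unfold u r = trans (finToFun-funToFin _ (funToFin r))
      (cong COL (tabulate-cong (cong (lookup u) ∘ finToFun-funToFin r)))

    same-colour : ∀ f g → SameOrder f g → COL (tabulate (H ∘ f)) ≡ COL (tabulate (H ∘ g))
    same-colour f g same with r , u , v , u-inc , v-inc , ur≡f , vr≡g ← common-indexing same = begin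
      COL (tabulate (H ∘ f))
        ≡⟨ cong COL (tabulate-cong λ i → trans (lookup-map (r i) H u) (cong H (ur≡f i))) ⟨
      COL (reindex (map H u) r)
        ≡⟨ unfold (map H u) r ⟨
      finToFun (COL′ (map H u)) (funToFin r)
        -- Both increasing sequences have the same `COL′`-colour, so their colours agree under every
        -- index map, in particular under `r`.
        ≡⟨ cong (λ t → finToFun t (funToFin r)) (trans (const u-inc) (sym (const v-inc))) ⟩
      finToFun (COL′ (map H v)) (funToFin r)
        ≡⟨ unfold (map H v) r ⟩
      COL (reindex (map H v) r)
        ≡⟨ cong COL (tabulate-cong λ i → trans (lookup-map (r i) H v) (cong H (vr≡g i))) ⟩
      COL (tabulate (H ∘ g))                  ∎
      where open ≡-Reasoning

  -- A matrix is read as a vector of length `n * d`, so that entries of different rows and columns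
  -- are all compared with one another.
  order-ramsey-matrix : ∀ {n d c} (COL : Vec (Vec ℕ d) n → Fin c) →
    ∃[ H ] StrictlyMonotone H × (∀ X Y →
      SameOrder (entry X) (entry Y) →
      COL (map (map H) X) ≡ COL (map (map H) Y))
  order-ramsey-matrix {n} {d} COL =
    let H , mono , same-colour = order-ramsey {n * d} (COL ∘ unflatten) in
    H , mono , λ X Y same →
      trans (cong COL (sym (flat H X)))
        (trans (same-colour (entries X) (entries Y) (λ s t → same (remQuot d s) (remQuot d t))) (cong COL (flat H Y)))
    where
    unflatten : Vec ℕ (n * d) → Vec (Vec ℕ d) n
    unflatten v = tabulate λ i → tabulate λ j → lookup v (combine i j)

    entries : Vec (Vec ℕ d) n → Fin (n * d) → ℕ
    entries X = entry X ∘ remQuot d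

    flat : ∀ H X → unflatten (tabulate (H ∘ entries X)) ≡ map (map H) X
    flat H X = begin
      unflatten (tabulate (H ∘ entries X))
        ≡⟨ tabulate-cong (λ i → tabulate-cong λ j → begin
             lookup (tabulate (H ∘ entries X)) (combine i j)  ≡⟨ lookup∘tabulate (H ∘ entries X) (combine i j) ⟩
             H (entries X (combine i j))                      ≡⟨ cong (H ∘ entry X) (remQuot-combine i j) ⟩
             H (lookup (lookup X i) j)                        ≡⟨ lookup-map j H (lookup X i) ⟨
             lookup (map H (lookup X i)) j                    ∎) ⟩
      tabulate (λ i → tabulate (lookup (map H (lookup X i))))
        ≡⟨ tabulate-cong (λ i → trans (tabulate∘lookup _) (sym (lookup-map i (map H) X))) ⟩
      tabulate (lookup (map (map H) X))
        ≡⟨ tabulate∘lookup _ ⟩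
      map (map H) X ∎
      where open ≡-Reasoning

-- Prefix codes and the paths they form.

-- code p a = 2^p (2a + 1)
code : ℕ → ℕ → ℕ
code zero    a = suc (2 * a)
code (suc p) a = 2 * code p a

code-monoʳ-< : ∀ p {a b} → a < b → code p a < code p b
code-monoʳ-< zero    a<b = s<s (*-monoʳ-< 2 a<b)
code-monoʳ-< (suc p) a<b = *-monoʳ-< 2 (code-monoʳ-< p a<b)

p<code : ∀ p a → p < code p a
p<code zero    a = z<s
p<code (suc p) a = begin
  2 + p                          ≤⟨ +-mono-≤ (≤-<-trans z≤n (p<code p a)) (p<code p a) ⟩
  code p a + code p a            ≡⟨ cong (code p a +_) (+-identityʳ (code p a)) ⟨
  2 * code p a                   ∎
  where open ≤-Reasoning

-- Parity separates exponent 0 from positive exponents; otherwise a factor 2 cancels.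
code-injective : ∀ p q {a b} → code p a ≡ code q b → p ≡ q × a ≡ b
code-injective zero    zero    eq = refl , *-cancelˡ-≡ _ _ 2 (suc-injective eq)
code-injective zero    (suc q) {a} {b} eq = contradiction (sym eq) (even≢odd (code q b) a)
code-injective (suc p) zero    {a} {b} eq = contradiction eq (even≢odd (code p a) b)
code-injective (suc p) (suc q) eq with code-injective p q (*-cancelˡ-≡ _ _ 2 eq)
... | refl , a≡b = refl , a≡b

-- The argument `p` is the code of the prefix already read; the empty prefix has code 0 in `path`.
branch : ∀ {d} → ℕ → Vec ℕ d → Vec ℕ d
branch p []       = []
branch p (a ∷ as) = code p a ∷ branch (code p a) as

branch-increasing : ∀ {d} p (x : Vec ℕ d) → Increasing (p ∷ branch p x)
branch-increasing p []       = [] ∷ []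
branch-increasing p (a ∷ as) with lt ∷ inc ← branch-increasing (code p a) as =
  (p<code p a ∷ All.map (<-trans (p<code p a)) lt) ∷ lt ∷ inc

lookup-branch : ∀ {d} p (x : Vec ℕ d) j →
  lookup (branch p x) j ≡ code (lookup (p ∷ branch p x) (inject₁ j)) (lookup x j)
lookup-branch p (a ∷ as) zero    = refl
lookup-branch p (a ∷ as) (suc j) = lookup-branch (code p a) as j

path : ∀ {d} → Vec ℕ d → Vec ℕ (suc d)
path x = 0 ∷ branch 0 x

-- Each entry below the root codes its parent entry together with one coordinate, and the code is
-- injective.
path-parent : ∀ {d} (x y : Vec ℕ d) j j′ → lookup (path x) (suc j) ≡ lookup (path y) (suc j′) →
  lookup (path x) (inject₁ j) ≡ lookup (path y) (inject₁ j′) × lookup x j ≡ lookup y j′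
path-parent x y j j′ eq = code-injective _ _ (trans (sym (lookup-branch 0 x j)) (trans eq (lookup-branch 0 y j′)))

-- Induction on depth: only the root has value 0, and below it equal entries have equal parents.
-- Equality of depths gives condition 4, equality of prefixes the injectivity of `key`.
path-injective : ∀ {d} (x y : Vec ℕ d) j j′ → lookup (path x) j ≡ lookup (path y) j′ →
  j ≡ j′ × (∀ i → i Fin.< j → lookup x i ≡ lookup y i)
path-injective {d} x y = <-weakInduction Determined root child
  where
  Determined : Fin (suc d) → Set
  Determined j = ∀ j′ → lookup (path x) j ≡ lookup (path y) j′ →
    j ≡ j′ × (∀ i → i Fin.< j → lookup x i ≡ lookup y i)

  positive : ∀ (z : Vec ℕ d) j → 0 < lookup (path z) (suc j)
  positive z j = All.lookup⁺ (AllPairs.head (branch-increasing 0 z)) j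

  root : Determined zero
  root zero     _  = refl , λ _ ()
  root (suc j′) eq = contradiction eq (<⇒≢ (positive y j′))

  child : ∀ j → Determined (inject₁ j) → Determined (suc j)
  child j ih zero     eq = contradiction (sym eq) (<⇒≢ (positive x j))
  child j ih (suc j′) eq with parents , x≡y ← path-parent x y j j′ eq
    with j≡j′ , prefix ← ih (inject₁ j′) parents
    with refl ← inject₁-injective j≡j′ = refl , agree
    where
    agree : ∀ i → i Fin.< suc j → lookup x i ≡ lookup y i
    agree i (s≤s i≤j) with m≤n⇒m<n∨m≡n i≤j
    ... | inj₁ i<j = prefix i (subst (toℕ i <_) (sym (toℕ-inject₁ j)) i<j)
    ... | inj₂ i≡j rewrite toℕ-injective i≡j = x≡y

-- The end of the path, coding all of `x`. For `d` positive it is the entry of exponent 0, which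
-- condition 1 orders.
key : ∀ {d} → Vec ℕ d → ℕ
key {d} x = lookup (path x) (fromℕ d)

key-injective : ∀ {d} {x y : Vec ℕ d} → key x ≡ key y → x ≡ y
key-injective {d} {x} {y} eq = trans (sym (tabulate∘lookup x)) (trans
  (tabulate-cong λ i → proj₂ (path-injective x y (fromℕ d) (fromℕ d) eq) i
    (subst (toℕ i <_) (sym (toℕ-fromℕ d)) (toℕ<n i)))
  (tabulate∘lookup y))

module _ {H : ℕ → ℕ} (mono : StrictlyMonotone H) where

  -- Equal prefixes have equal codes, so the first difference keeps its place, and there `code p`
  -- and `H` are increasing.
  branch-lex : ∀ {d} p {x y : Vec ℕ d} → Lex-< _≡_ _<_ x y →
               Lex-< _≡_ _<_ (map H (branch p x)) (map H (branch p y))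
  branch-lex p (this a<b _)                  = this (mono (code-monoʳ-< p a<b)) refl
  branch-lex p {a ∷ x} (next refl x<y) = next refl (branch-lex (code p a) x<y)

-- Order patterns of key-sorted vectors are coloring rules.

AllPairs-lookup : ∀ {A : Set} {R : Rel A 0ℓ} {n} {xs : Vec A n} → AllPairs R xs →
                  ∀ {i j} → i Fin.< j → R (lookup xs i) (lookup xs j)
AllPairs-lookup (r ∷ _)  {zero}  {suc j} _         = All.lookup⁺ r j
AllPairs-lookup (_ ∷ rs) {suc i} {suc j} (s≤s i<j) = AllPairs-lookup rs i<j

opposite-anti-< : ∀ {d} {j j′ : Fin d} → j Fin.< j′ → opposite j′ Fin.< opposite j
opposite-anti-< {d} {j} {j′} j<j′ =
  subst₂ _<_ (sym (opposite-prop j′)) (sym (opposite-prop j)) (∸-monoʳ-< (s<s j<j′) (toℕ<n j′))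

-- Raising the exponent by one moves to the parent on the path, which brings condition 5 under
-- `path-parent`.
opposite-pred : ∀ {d} {j j⁻ : Fin d} → toℕ j ≡ suc (toℕ j⁻) → suc (opposite j) ≡ inject₁ (opposite j⁻)
opposite-pred {d} {j} {j⁻} eq = toℕ-injective (begin
  suc (toℕ (opposite j))      ≡⟨ cong suc (opposite-prop j) ⟩
  suc (d ∸ suc (toℕ j))       ≡⟨ +-∸-assoc 1 (toℕ<n j) ⟨
  d ∸ toℕ j                   ≡⟨ cong (d ∸_) eq ⟩
  d ∸ suc (toℕ j⁻)            ≡⟨ opposite-prop j⁻ ⟨
  toℕ (opposite j⁻)           ≡⟨ toℕ-inject₁ (opposite j⁻) ⟨
  toℕ (inject₁ (opposite j⁻)) ∎)
  where open ≡-Reasoning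

opposite-injective : ∀ {d} {j j′ : Fin d} → opposite j ≡ opposite j′ → j ≡ j′
opposite-injective {j = j} {j′} eq =
  trans (sym (opposite-involutive j)) (trans (cong opposite eq) (opposite-involutive j′))

-- The coordinates of a vector are listed from a_{d-1} down to a_0, whereas j is the exponent.
value : ∀ {n d} → Vec (Vec ℕ d) n → Fin n × Fin d → ℕ
value xs (i , j) = lookup (path (lookup xs i)) (suc (opposite j))

orderMatrix : ∀ {n d} → Vec (Vec ℕ d) n → Vec (Vec (Vec (Vec Bool d) n) d) n
orderMatrix xs = tabulate λ i → tabulate λ j → tabulate λ i′ → tabulate λ j′ →
  isYes (value xs (i , j) ≤? value xs (i′ , j′))

orderMatrix-⇔ : ∀ {n d} (xs : Vec (Vec ℕ d) n) p q → ⟦ orderMatrix xs ⟧ p q ⇔ value xs p ≤ value xs q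
orderMatrix-⇔ {n} {d} xs (i , j) (i′ , j′) = mk⇔ (toWitness ∘ subst T eq) (subst T (sym eq) ∘ fromWitness)
  where
  f = λ i j i′ j′ → isYes (value xs (i , j) ≤? value xs (i′ , j′))
  f₁ = λ i → tabulate λ j → tabulate λ i′ → tabulate (f i j i′)

  eq : lookup (lookup (lookup (lookup (orderMatrix xs) i) j) i′) j′ ≡ f i j i′ j′
  eq = begin
    lookup (lookup (lookup (lookup (orderMatrix xs) i) j) i′) j′
      ≡⟨ cong (λ M → lookup (lookup (lookup M j) i′) j′) (lookup∘tabulate f₁ i) ⟩
    lookup (lookup (lookup (f₁ i) j) i′) j′
      ≡⟨ cong (λ M → lookup (lookup M i′) j′) (lookup∘tabulate (λ j → tabulate λ i′ → tabulate (f i j i′)) j) ⟩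
    lookup (lookup (tabulate λ i′ → tabulate (f i j i′)) i′) j′
      ≡⟨ cong (λ M → lookup M j′) (lookup∘tabulate (λ i′ → tabulate (f i j i′)) i′) ⟩
    lookup (tabulate (f i j i′)) j′
      ≡⟨ lookup∘tabulate (f i j i′) j′ ⟩
    f i j i′ j′ ∎
    where open ≡-Reasoning

candidate : ∀ {n d} → Vec (Vec ℕ d) n → Candidate n d 1
candidate xs = replicate _ zero , orderMatrix xs

-- The matrix records comparisons of `value`, indexed by exponent; `opposite` translates them to the
-- positions used by `entry`.
candidate-sameOrder : ∀ {n d} (xs ys : Vec (Vec ℕ d) n) → candidate xs ≡ candidate ys →
  SameOrder (entry (map (branch 0) xs)) (entry (map (branch 0) ys))
candidate-sameOrder {n} {d} xs ys eq (i , j) (i′ , j′) =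
  subst₂ _⇔_ (cong₂ _≤_ (entry≡ xs i j) (entry≡ xs i′ j′)) (cong₂ _≤_ (entry≡ ys i j) (entry≡ ys i′ j′))
    (mk⇔ (step xs ys (cong proj₂ eq)) (step ys xs (cong proj₂ (sym eq))))
  where
  entry≡ : ∀ zs i j → value zs (i , opposite j) ≡ entry (map (branch 0) zs) (i , j)
  entry≡ zs i j = sym (trans (cong (λ v → lookup v j) (lookup-map i (branch 0) zs))
    (cong (lookup (branch 0 (lookup zs i))) (sym (opposite-involutive j))))
  step : ∀ {p q} (xs ys : Vec (Vec ℕ d) n) →
         orderMatrix xs ≡ orderMatrix ys → value xs p ≤ value xs q → value ys p ≤ value ys q
  step {p} {q} xs ys eq = to (orderMatrix-⇔ ys p q) ∘ subst (λ M → ⟦ M ⟧ p q) eq ∘ from (orderMatrix-⇔ xs p q)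

-- Condition 1 is the sorting by `key`. Conditions 3, 4 and 5 express that entries increase along a
-- path, that equal entries have equal depth, and that equal entries have equal parents.
candidate-CR : ∀ {n d} (xs : Vec (Vec ℕ d) n) → AllPairs (_<_ on key) xs → CR (candidate xs)
candidate-CR xs sorted = record
  { isTotalPreorder = record
    { isPreorder = record
      { isEquivalence = isEquivalence
      ; reflexive = λ { {p} refl → from (⪯⇔≤ p p) ≤-refl }
      ; trans = λ {p} {q} {r} p⪯q q⪯r → from (⪯⇔≤ p r) (≤-trans (to (⪯⇔≤ p q) p⪯q) (to (⪯⇔≤ q r) q⪯r))
      }
    ; total = λ p q → Sum.map (from (⪯⇔≤ p q)) (from (⪯⇔≤ q p)) (≤-total (value xs p) (value xs q))
    }
  ; cond₁  = λ { i i′ zero _ i<i′ → <⇒≺ (AllPairs-lookup sorted i<i′) }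
  -- For `d ≡ 0` every key is 0, so a sorted vector has at most one row.
  ; cond₁₀ = λ { refl i i′ i<i′ → contradiction (AllPairs-lookup sorted i<i′) λ () }
  ; cond₂  = λ i i′ j _ → Y-unique _ _
  ; cond₃  = λ i j j′ j′<j → <⇒≺ (AllPairs-lookup (branch-increasing 0 (lookup xs i)) (s<s (opposite-anti-< j′<j)))
  ; cond₄  = λ i i′ j j′ eq → opposite-injective (suc-injectiveᶠ
               (proj₁ (path-injective (lookup xs i) (lookup xs i′) (suc (opposite j)) (suc (opposite j′)) (≈⇒≡ eq))))
  ; cond₅  = λ i i′ j j⁻ eq apart together → apart (≡⇒≈ (subst
               (λ k → lookup (path (lookup xs i)) k ≡ lookup (path (lookup xs i′)) k)
               (sym (opposite-pred eq))
               (proj₁ (path-parent (lookup xs i) (lookup xs i′) (opposite j⁻) (opposite j⁻) (≈⇒≡ together)))))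
  }
  where
  open Induced (⟦ orderMatrix xs ⟧)

  ⪯⇔≤ = orderMatrix-⇔ xs

  Y-unique : (a b : Fin 1) → a ≡ b
  Y-unique zero zero = refl

  <⇒≺ : ∀ {p q} → value xs p < value xs q → p ≺ q
  <⇒≺ {p} {q} lt = from (⪯⇔≤ p q) (<⇒≤ lt) , <⇒≱ lt ∘ to (⪯⇔≤ q p)

  ≈⇒≡ : ∀ {p q} → p ≈ q → value xs p ≡ value xs q
  ≈⇒≡ {p} {q} (p⪯q , q⪯p) = ≤-antisym (to (⪯⇔≤ p q) p⪯q) (to (⪯⇔≤ q p) q⪯p)

  ≡⇒≈ : ∀ {p q} → value xs p ≡ value xs q → p ≈ q
  ≡⇒≈ {p} {q} eq = from (⪯⇔≤ p q) (≤-reflexive eq) , from (⪯⇔≤ q p) (≤-reflexive (sym eq))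

-- Counting subsets, images of vectors, least witnesses.

∣⁅x⁆∪p∣≤1+∣p∣ : ∀ {n} (x : Fin n) (p : Subset n) → ∣ ⁅ x ⁆ ∪ p ∣ ≤ suc ∣ p ∣
∣⁅x⁆∪p∣≤1+∣p∣ zero    (outside ∷ p) = s≤s (≤-reflexive (cong ∣_∣ (∪-identityˡ p)))
∣⁅x⁆∪p∣≤1+∣p∣ zero    (inside  ∷ p) = s≤s (m≤n⇒m≤1+n (≤-reflexive (cong ∣_∣ (∪-identityˡ p))))
∣⁅x⁆∪p∣≤1+∣p∣ (suc x) (outside ∷ p) = ∣⁅x⁆∪p∣≤1+∣p∣ x p
∣⁅x⁆∪p∣≤1+∣p∣ (suc x) (inside  ∷ p) = s≤s (∣⁅x⁆∪p∣≤1+∣p∣ x p)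

-- The subset lies in the union of the singletons of the list, and each singleton adds at most one
-- element.
listed⇒∣p∣≤length : ∀ {n} {p : Subset n} (l : List (Fin n)) → (∀ {x} → x ∈ˢ p → x List.∈ l) → ∣ p ∣ ≤ length l
listed⇒∣p∣≤length {n} l listed = ≤-trans (p⊆q⇒∣p∣≤∣q∣ (covered l ∘ listed)) (size l)
  where
  cover : List (Fin _) → Subset _
  cover = List.foldr (λ x q → ⁅ x ⁆ ∪ q) Subset.⊥

  covered : ∀ l {x} → x List.∈ l → x ∈ˢ cover l
  covered (x ∷ l) (here refl) = x∈p∪q⁺ (inj₁ (x∈⁅x⁆ x))
  covered (x ∷ l) (there x∈l) = x∈p∪q⁺ (inj₂ (covered l x∈l))

  size : ∀ l → ∣ cover l ∣ ≤ length l
  size []      = ≤-reflexive (∣⊥∣≡0 n)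
  size (x ∷ l) = ≤-trans (∣⁅x⁆∪p∣≤1+∣p∣ x (cover l)) (s≤s (size l))

∈-map-cong : ∀ {A B : Set} (f : A → B) {m n} {xs : Vec A m} {ys : Vec A n} →
             (∀ {z} → z ∈ xs ⇔ z ∈ ys) → ∀ {z} → z ∈ map f xs ⇔ z ∈ map f ys
∈-map-cong f same = mk⇔ (include (to same)) (include (from same))
  where
  include : ∀ {m n} {xs : Vec _ m} {ys : Vec _ n} → (∀ {z} → z ∈ xs → z ∈ ys) →
            ∀ {z} → z ∈ map f xs → z ∈ map f ys
  include ⊆ = All.lookup (All.map⁺ (∈⇒All (∈-map⁺ f ∘ ⊆)))

All-image : ∀ {A B : Set} {f : A → B} {n} {ys : Vec B n} → All (λ y → ∃[ x ] y ≡ f x) ys → ∃[ xs ] ys ≡ map f xs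
All-image []               = [] , refl
All-image ((x , y≡) ∷ ys≡) = let xs , eq = All-image ys≡ in x ∷ xs , cong₂ _∷_ y≡ eq

AllPairs-map⁻ : ∀ {A B : Set} {R : Rel B 0ℓ} {f : A → B} {n} {xs : Vec A n} →
                AllPairs R (map f xs) → AllPairs (R on f) xs
AllPairs-map⁻ {xs = []}    []       = []
AllPairs-map⁻ {xs = _ ∷ _} (r ∷ rs) = All.map⁻ r ∷ AllPairs-map⁻ rs

-- Descent below the bound `b`. The level is arbitrary because `Suffices` lies in `Set₁`.
least : ∀ {ℓ} → ExcludedMiddle ℓ → (Q : ℕ → Set ℓ) → ∀ {b k} → k < b → Q k → ∃[ m ] Q m × (∀ j → Q j → m ≤ j)
least em Q {suc b} {k} (s≤s k≤b) q with em {∃[ j ] j < b × Q j}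
... | yes (j , j<b , q′) = least em Q j<b q′
... | no  none           = k , q , λ j q′ → ≤-trans k≤b (≮⇒≥ λ j<b → none (j , j<b , q′))

-- The copy of ω^d and the colours it attains.

module Upper (em : ExcludedMiddle 0ℓ) {n d c : ℕ} (COL : [ _<ω_ {d} {1} ]-subset n → Fin (suc c)) where

  open IsStrictTotalOrder (<ω-isStrictTotalOrder {d} {1}) using ()
    renaming (trans to <ω-trans; asym to <ω-asym; irrefl to <ω-irrefl)

  -- Only members are compared: `e` is listed in the ordinal order, whereas the rows of `X` will
  -- follow the order of `key`.
  Enumerates : Vec (Vec ℕ d) n → [ _<ω_ {d} {1} ]-subset n → Set
  Enumerates X e = ∀ z → z ∈ elements e ⇔ z ∈ map (zero ,_) X

  rowColour : Vec (Vec ℕ d) n → Fin (suc c)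
  rowColour X with em {∃[ e ] Enumerates X e}
  ... | yes (e , _) = COL e
  -- Default for matrices with a repeated row; it exists because there is at least one colour.
  ... | no  _       = zero

  COL-cong : ∀ e e′ → (∀ {z} → z ∈ elements e ⇔ z ∈ elements e′) → COL e ≡ COL e′
  COL-cong (subset xs p) (subset ys q) same
    -- Excluded middle recovers usable proofs of increasingness from the irrelevant ones.
    with refl ← sorted-unique <ω-trans <ω-asym (recompute em p) (recompute em q) same = refl

  rowColour-rows : ∀ e X → Enumerates X e → rowColour X ≡ COL e
  rowColour-rows e X same with em {∃[ e ] Enumerates X e}
  ... | yes (e′ , same′) = COL-cong e′ e (λ {z} → mk⇔ (from (same z) ∘ to (same′ z)) (from (same′ z) ∘ to (same z)))
  ... | no  none         = contradiction (e , same) none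

  open OrderRamsey em

  homogeneous = order-ramsey-matrix rowColour
  H       = proj₁ homogeneous
  H-mono  = proj₁ (proj₂ homogeneous)

  -- `branch 0` makes the order pattern a coloring rule; `H` makes the colour depend on that pattern
  -- alone.
  embed : Vec ℕ d → ω^ d · 1
  embed x = zero , map H (branch 0 x)

  S′ : Pred (ω^ d · 1) 0ℓ
  S′ z = ∃[ x ] z ≡ embed x

  -- Strict monotonicity is the substance; injectivity and order reflection follow by trichotomy of
  -- `_<ω_`.
  orderEquivalent : OrderEquivalent _<ω_ S′
  orderEquivalent = f , record
    { isOrderMonomorphism = record
      { isOrderHomomorphism = record { cong = cong (proj₁ ∘ f) ; mono = λ {x} {y} → mono {x} {y} }
      ; injective = injective
      ; cancel    = cancel
      }
    ; surjective = λ { (_ , x , refl) → (zero , x) , λ { refl → refl } }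
    }
    where
    f : ω^ d · 1 → ∃ S′
    f (_ , x) = embed x , x , refl

    mono : ∀ {x y} → x <ω y → proj₁ (f x) <ω proj₁ (f y)
    mono {zero , _} {zero , _} (inj₁ ())
    mono (inj₂ (_ , x<y)) = inj₂ (refl , branch-lex H-mono 0 x<y)

    injective : ∀ {x y} → proj₁ (f x) ≡ proj₁ (f y) → x ≡ y
    injective {x} {y} eq with <ω-compare x y
    ... | tri< x<y _ _ = contradiction (mono x<y) (<ω-irrefl eq)
    ... | tri≈ _ x≡y _ = x≡y
    ... | tri> _ _ y<x = contradiction (mono y<x) (<ω-irrefl (sym eq))

    cancel : ∀ {x y} → proj₁ (f x) <ω proj₁ (f y) → x <ω y
    cancel {x} {y} lt with <ω-compare x y
    ... | tri< x<y _ _  = x<y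
    ... | tri≈ _ refl _ = contradiction lt (<ω-irrefl refl)
    ... | tri> _ _ y<x  = contradiction (mono y<x) (<ω-asym lt)

  sortedColour : Vec (Vec ℕ d) n → Fin (suc c)
  sortedColour ys = rowColour (map (map H) (map (branch 0) ys))

  sortedColour-cong : ∀ xs ys → candidate xs ≡ candidate ys → sortedColour xs ≡ sortedColour ys
  sortedColour-cong xs ys eq = proj₂ (proj₂ homogeneous) _ _ (candidate-sameOrder xs ys eq)

  -- The preimages of the elements have distinct keys, so they can be re-sorted by `key`. The
  -- members stay the same, hence so does the colour.
  sort-subset : ∀ e → _⊆ₛ_ _<ω_ e S′ → ∃[ ys ] AllPairs (_<_ on key) ys × sortedColour ys ≡ COL e
  sort-subset e@(subset zs p) zs⊆S′ with xs , refl ← All-image zs⊆S′ =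
    let ys , sorted , ys~xs = sort (λ {x} {y} {z} → <-trans {key x} {key y} {key z}) xs
          (AllPairs.map distinct (AllPairs-map⁻ (recompute em p)))
        embed≡ = trans (map-∘ (zero ,_) (map H ∘ branch 0) ys) (cong (map (zero ,_)) (map-∘ (map H) (branch 0) ys))
    in ys , sorted , rowColour-rows e _ λ z → subst (λ zs → z ∈ map embed xs ⇔ z ∈ zs) embed≡
         (∈-map-cong embed (mk⇔ (from ys~xs) (to ys~xs)))
    where
    distinct : ∀ {x y} → embed x <ω embed y → key x < key y ⊎ key y < key x
    distinct {x} {y} lt with <-cmp (key x) (key y)
    ... | tri< kx<ky _ _ = inj₁ kx<ky
    ... | tri≈ _ kx≡ky _ = contradiction lt (<ω-irrefl (cong embed (key-injective kx≡ky)))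
    ... | tri> _ _ ky<kx = inj₂ ky<kx

  -- A representative with the given pattern is chosen, and `sortedColour-cong` makes the choice
  -- immaterial; candidates that are no pattern get the default colour.
  ruleColour : Candidate n d 1 → Fin (suc c)
  ruleColour r with em {∃[ ys ] candidate ys ≡ r}
  ... | yes (ys , _) = sortedColour ys
  ... | no  _        = zero

  ruleColour-candidate : ∀ ys → ruleColour (candidate ys) ≡ sortedColour ys
  ruleColour-candidate ys with em {∃[ xs ] candidate xs ≡ candidate ys}
  ... | yes (xs , eq) = sortedColour-cong xs ys eq
  ... | no  none      = contradiction (ys , refl) none

  Attained : Fin (suc c) → Set
  Attained a = ∃[ e ] _⊆ₛ_ _<ω_ e S′ × COL e ≡ a

  attained? : Fin (suc c) → Bool
  attained? a = isYes (em {Attained a})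

  image : Subset (suc c)
  image = tabulate attained?

  isImage : IsImage _<ω_ COL S′ image
  isImage a = mk⇔
    (λ a∈ → toWitness {a? = em} (from T-≡ (trans (sym (lookup∘tabulate attained? a)) ([]=⇒lookup a∈))))
    (λ h → lookup⇒[]= a image (trans (lookup∘tabulate attained? a) (to T-≡ (fromWitness {a? = em} h))))

  -- Every attained colour is `ruleColour` of the coloring rule of a key-sorted vector, so the
  -- values of `ruleColour` on `allCRs` cover the image.
  ∣image∣≤P : ∣ image ∣ ≤ P n d 1
  ∣image∣≤P = subst (∣ image ∣ ≤_) (length-map ruleColour (allCRs n d 1))
    (listed⇒∣p∣≤length (List.map ruleColour (allCRs n d 1)) listed)
    where
    listed : ∀ {a} → a ∈ˢ image → a List.∈ List.map ruleColour (allCRs n d 1)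
    listed {a} a∈ with e , e⊆S′ , refl ← to (isImage a) a∈
                  with ys , sorted , eq ← sort-subset e e⊆S′ =
      subst (List._∈ List.map ruleColour (allCRs n d 1)) (trans (ruleColour-candidate ys) eq)
        (∈ᴸ-map⁺ ruleColour (from (∈-allCRs (candidate ys)) (candidate-CR ys sorted)))

Suffices-P : ExcludedMiddle 0ℓ → ∀ n d → Suffices (_<ω_ {d} {1}) n (P n d 1)
Suffices-P em n d (suc c) _ COL = S′ , orderEquivalent , image , isImage , ∣image∣≤P
  where open Upper em COL

theorem8p3 : (∀ {ℓ} → ExcludedMiddle ℓ) →
    ∀ (n d : ℕ) → ∃[ t ] IsT (_<ω_ {d} {1}) n t × t ≤∞ [ P n d 1 ]
theorem8p3 em n d =
  let upper = Suffices-P em n d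
      -- That `P n d 1` suffices starts the descent, so T(n,ω^d) is finite; minimality then bounds
      -- it by `P n d 1`.
      t , suffices , minimal = least em (Suffices (_<ω_ {d} {1}) n) (n<1+n (P n d 1)) upper
  in [ t ] , (suffices , minimal) , [ minimal _ upper ]
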